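{- There exists an infinite set $A\subseteq \mathbb{R}^{2}$ with the following two properties: (1) for every positive integer $n$ and every subset $P\subseteq A$ consisting of $n$ points, there exists a subset $P'\subseteq P$ with $|P'|\ge n/2$ such that no three points of $P'$ are collinear; (2) there is no partition $A = A_1\cup\cdots\cup A_m$ of $A$ into finitely many sets such that, for each $i$, no three points of $A_i$ are collinear. -}

module Defs where

open import Data.Fin.Base using (Fin)
open import Data.Nat.Base as ℕ using (ℕ; _⊔_)
import Data.Nat.Properties as ℕ
open import Data.Product.Base using (Σ; ∃-syntax; _×_; _,_; proj₁; proj₂)
open import Data.Product.Relation.Binary.Pointwise.NonDependent using (×-setoid)
open import Data.Rational.Base as ℚ using (ℚ; 0ℚ; 1ℚ; ½; ∣_∣)
import Data.Rational.Properties as ℚ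
open import Data.Rational.Solver using (module +-*-Solver)
open import Function.Bundles using (Injection; Inverse)
open import Level using (0ℓ; suc)
open import Relation.Binary.Bundles using (Setoid)
import Relation.Binary.Construct.On as On
open import Relation.Binary.Definitions using (_Respects_)
open import Relation.Binary.PropositionalEquality
  using (_≡_; _≢_; refl; sym; trans; cong; cong₂; subst; setoid)
open import Relation.Nullary.Negation using (¬_)
open import Relation.Unary using (Pred; _⊆_; _≐_; _⊥_; ⋃)

ε/2+ε/2≡ε : ∀ ε → ½ ℚ.* ε ℚ.+ ½ ℚ.* ε ≡ ε
ε/2+ε/2≡ε ε =
  trans (sym (ℚ.*-distribʳ-+ ε ½ ½)) (ℚ.*-identityˡ ε)

ε/2>0 : ∀ {ε} → 0ℚ ℚ.< ε → 0ℚ ℚ.< ½ ℚ.* ε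
ε/2>0 {ε} ε>0 = subst (ℚ._< ½ ℚ.* ε) (ℚ.*-zeroʳ ½) (ℚ.*-monoʳ-<-pos ½ ε>0)

∣p-q∣-sym : ∀ p q → ∣ p ℚ.- q ∣ ≡ ∣ q ℚ.- p ∣
∣p-q∣-sym p q = trans (cong ∣_∣ eq) (ℚ.∣-p∣≡∣p∣ (q ℚ.- p))
  where
  open +-*-Solver
  eq : p ℚ.- q ≡ ℚ.- (q ℚ.- p)
  eq = solve 2 (λ p q → p :- q := :- (q :- p)) refl p q

∣p-r∣≤∣p-q∣+∣q-r∣ : ∀ p q r → ∣ p ℚ.- r ∣ ℚ.≤ ∣ p ℚ.- q ∣ ℚ.+ ∣ q ℚ.- r ∣
∣p-r∣≤∣p-q∣+∣q-r∣ p q r =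
  subst (λ d → ∣ d ∣ ℚ.≤ ∣ p ℚ.- q ∣ ℚ.+ ∣ q ℚ.- r ∣) (sym eq)
    (ℚ.∣p+q∣≤∣p∣+∣q∣ (p ℚ.- q) (q ℚ.- r))
  where
  open +-*-Solver
  eq : p ℚ.- r ≡ (p ℚ.- q) ℚ.+ (q ℚ.- r)
  eq = solve 3 (λ p q r → p :- r := (p :- q) :+ (q :- r)) refl p q r

sum-diff : ∀ a b c d →
  ∣ (a ℚ.+ b) ℚ.- (c ℚ.+ d) ∣ ℚ.≤ ∣ a ℚ.- c ∣ ℚ.+ ∣ b ℚ.- d ∣
sum-diff a b c d =
  subst (λ e → ∣ e ∣ ℚ.≤ ∣ a ℚ.- c ∣ ℚ.+ ∣ b ℚ.- d ∣) (sym eq)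
    (ℚ.∣p+q∣≤∣p∣+∣q∣ (a ℚ.- c) (b ℚ.- d))
  where
  open +-*-Solver
  eq : (a ℚ.+ b) ℚ.- (c ℚ.+ d) ≡ (a ℚ.- c) ℚ.+ (b ℚ.- d)
  eq = solve 4 (λ a b c d → (a :+ b) :- (c :+ d) := (a :- c) :+ (b :- d))
         refl a b c d

product-diff : ∀ a b c d →
  ∣ a ℚ.* b ℚ.- c ℚ.* d ∣ ℚ.≤
  ∣ a ∣ ℚ.* ∣ b ℚ.- d ∣ ℚ.+ ∣ d ∣ ℚ.* ∣ a ℚ.- c ∣
product-diff a b c d = begin
  ∣ a ℚ.* b ℚ.- c ℚ.* d ∣                             ≡⟨ cong ∣_∣ eq ⟩
  ∣ a ℚ.* (b ℚ.- d) ℚ.+ d ℚ.* (a ℚ.- c) ∣             ≤⟨ ℚ.∣p+q∣≤∣p∣+∣q∣ (a ℚ.* (b ℚ.- d)) (d ℚ.* (a ℚ.- c)) ⟩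
  ∣ a ℚ.* (b ℚ.- d) ∣ ℚ.+ ∣ d ℚ.* (a ℚ.- c) ∣         ≡⟨ cong₂ ℚ._+_ (ℚ.∣p*q∣≡∣p∣*∣q∣ a (b ℚ.- d)) (ℚ.∣p*q∣≡∣p∣*∣q∣ d (a ℚ.- c)) ⟩
  ∣ a ∣ ℚ.* ∣ b ℚ.- d ∣ ℚ.+ ∣ d ∣ ℚ.* ∣ a ℚ.- c ∣     ∎
  where
  open ℚ.≤-Reasoning
  open +-*-Solver
  eq : a ℚ.* b ℚ.- c ℚ.* d ≡ a ℚ.* (b ℚ.- d) ℚ.+ d ℚ.* (a ℚ.- c)
  eq = solve 4 (λ a b c d → a :* b :- c :* d := a :* (b :- d) :+ d :* (a :- c))
         refl a b c d

scale : ∀ K .{{_ : ℚ.Positive K}} ε → 0ℚ ℚ.< ε →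
        ∃[ δ ] (0ℚ ℚ.< δ × K ℚ.* δ ≡ ε)
scale K ε ε>0 = 1/K ℚ.* ε
  , subst (ℚ._< 1/K ℚ.* ε) (ℚ.*-zeroʳ 1/K) (ℚ.*-monoʳ-<-pos 1/K {{ℚ.1/pos⇒pos K}} ε>0)
  , trans (sym (ℚ.*-assoc K 1/K ε))
      (trans (cong (ℚ._* ε) (ℚ.*-inverseʳ K {{K≢0}})) (ℚ.*-identityˡ ε))
  where
  K≢0 = ℚ.pos⇒nonZero K
  1/K = ℚ.1/_ K {{K≢0}}

bounded-* : ∀ {K p q δ} .{{_ : ℚ.Positive K}} → ∣ p ∣ ℚ.≤ K → ∣ q ∣ ℚ.< δ →
            ∣ p ∣ ℚ.* ∣ q ∣ ℚ.< K ℚ.* δ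
bounded-* {K} {p} {q} ∣p∣≤K ∣q∣<δ = ℚ.≤-<-trans
  (ℚ.*-monoʳ-≤-nonNeg ∣ q ∣ {{ℚ.∣-∣-nonNeg q}} ∣p∣≤K)
  (ℚ.*-monoʳ-<-pos K ∣q∣<δ)

-- Real numbers are Cauchy sequences of rationals; two of them are equal
-- when their difference tends to 0, so equality is _≈_ and not _≡_.
record ℝ : Set where
  constructor mkℝ
  field
    seq    : ℕ → ℚ
    cauchy : ∀ ε → 0ℚ ℚ.< ε → ∃[ N ] (∀ m n → N ℕ.≤ m → N ℕ.≤ n →
               ∣ seq m ℚ.- seq n ∣ ℚ.< ε)

open ℝ public

infix 4 _≈_

record _≈_ (x y : ℝ) : Set where
  constructor mk≈
  field
    difference→0 : ∀ ε → 0ℚ ℚ.< ε → ∃[ N ] (∀ n → N ℕ.≤ n →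
                     ∣ seq x n ℚ.- seq y n ∣ ℚ.< ε)

open _≈_ public

≈-refl : ∀ {x} → x ≈ x
≈-refl {x} = mk≈ λ ε ε>0 → 0 , λ n _ →
  subst (λ d → ∣ d ∣ ℚ.< ε) (sym (ℚ.+-inverseʳ (seq x n))) ε>0

≈-sym : ∀ {x y} → x ≈ y → y ≈ x
≈-sym {x} {y} x≈y = mk≈ λ ε ε>0 → let N , close = difference→0 x≈y ε ε>0 in
  N , λ n N≤n → subst (ℚ._< ε) (∣p-q∣-sym (seq x n) (seq y n)) (close n N≤n)

≈-trans : ∀ {x y z} → x ≈ y → y ≈ z → x ≈ z
≈-trans {x} {y} {z} x≈y y≈z = mk≈ λ ε ε>0 →
  let M , close₁ = difference→0 x≈y (½ ℚ.* ε) (ε/2>0 ε>0)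
      N , close₂ = difference→0 y≈z (½ ℚ.* ε) (ε/2>0 ε>0)
  in M ⊔ N , λ n M⊔N≤n →
     ℚ.≤-<-trans (∣p-r∣≤∣p-q∣+∣q-r∣ (seq x n) (seq y n) (seq z n))
       (subst (_ ℚ.<_) (ε/2+ε/2≡ε ε)
         (ℚ.+-mono-< (close₁ n (ℕ.m⊔n≤o⇒m≤o M N M⊔N≤n))
                     (close₂ n (ℕ.m⊔n≤o⇒n≤o M N M⊔N≤n))))

ℝ-setoid : Setoid 0ℓ 0ℓ
ℝ-setoid = record
  { Carrier       = ℝ
  ; _≈_           = _≈_
  ; isEquivalence = record { refl = ≈-refl ; sym = ≈-sym ; trans = ≈-trans }
  }

fromℚ : ℚ → ℝ
fromℚ q = mkℝ (λ _ → q) λ ε ε>0 → 0 , λ _ _ _ _ →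
  subst (λ d → ∣ d ∣ ℚ.< ε) (sym (ℚ.+-inverseʳ q)) ε>0

0ℝ : ℝ
0ℝ = fromℚ 0ℚ

infixl 6 _+_
infixl 7 _*_

_+_ : ℝ → ℝ → ℝ
x + y = mkℝ (λ n → seq x n ℚ.+ seq y n) λ ε ε>0 →
  let M , close₁ = cauchy x (½ ℚ.* ε) (ε/2>0 ε>0)
      N , close₂ = cauchy y (½ ℚ.* ε) (ε/2>0 ε>0)
  in M ⊔ N , λ m n ≤m ≤n →
     ℚ.≤-<-trans (sum-diff (seq x m) (seq y m) (seq x n) (seq y n))
       (subst (_ ℚ.<_) (ε/2+ε/2≡ε ε)
         (ℚ.+-mono-<
           (close₁ m n (ℕ.m⊔n≤o⇒m≤o M N ≤m) (ℕ.m⊔n≤o⇒m≤o M N ≤n))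
           (close₂ m n (ℕ.m⊔n≤o⇒n≤o M N ≤m) (ℕ.m⊔n≤o⇒n≤o M N ≤n))))

eventually-bounded : ∀ x → ∃[ K ] ∃[ N ] (0ℚ ℚ.< K × (∀ n → N ℕ.≤ n → ∣ seq x n ∣ ℚ.≤ K))
eventually-bounded x = K , N , K>0 , bound
  where
  open ℚ.≤-Reasoning
  open +-*-Solver
  N = proj₁ (cauchy x 1ℚ (ℚ.positive⁻¹ 1ℚ))
  K = 1ℚ ℚ.+ ∣ seq x N ∣

  K>0 : 0ℚ ℚ.< K
  K>0 = ℚ.+-mono-<-≤ (ℚ.positive⁻¹ 1ℚ) (ℚ.0≤∣p∣ (seq x N))

  bound : ∀ n → N ℕ.≤ n → ∣ seq x n ∣ ℚ.≤ K
  bound n N≤n = begin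
    ∣ seq x n ∣                                ≡⟨ cong ∣_∣ (solve 2 (λ p q → p := (p :- q) :+ q) refl (seq x n) (seq x N)) ⟩
    ∣ (seq x n ℚ.- seq x N) ℚ.+ seq x N ∣      ≤⟨ ℚ.∣p+q∣≤∣p∣+∣q∣ (seq x n ℚ.- seq x N) (seq x N) ⟩
    ∣ seq x n ℚ.- seq x N ∣ ℚ.+ ∣ seq x N ∣    ≤⟨ ℚ.+-monoˡ-≤ ∣ seq x N ∣ (ℚ.<⇒≤ (proj₂ (cauchy x 1ℚ (ℚ.positive⁻¹ 1ℚ)) n N N≤n ℕ.≤-refl)) ⟩
    K                                          ∎

_*_ : ℝ → ℝ → ℝ
x * y = mkℝ (λ n → seq x n ℚ.* seq y n) *-cauchy
  where
  *-cauchy : ∀ ε → 0ℚ ℚ.< ε → ∃[ N ] (∀ m n → N ℕ.≤ m → N ℕ.≤ n →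
    ∣ seq x m ℚ.* seq y m ℚ.- seq x n ℚ.* seq y n ∣ ℚ.< ε)
  *-cauchy ε ε>0 =
    let K , M , K>0 , x-bound = eventually-bounded x
        L , N , L>0 , y-bound = eventually-bounded y
        instance
          K-pos = ℚ.positive K>0
          L-pos = ℚ.positive L>0
        δ , δ>0 , Kδ≡ = scale K (½ ℚ.* ε) (ε/2>0 ε>0)
        η , η>0 , Lη≡ = scale L (½ ℚ.* ε) (ε/2>0 ε>0)
        M′ , y-close = cauchy y δ δ>0
        N′ , x-close = cauchy x η η>0
        P = (M ⊔ N) ⊔ (M′ ⊔ N′)
    in P , λ m n ≤m ≤n →
      let M⊔N≤m   = ℕ.m⊔n≤o⇒m≤o (M ⊔ N) (M′ ⊔ N′) ≤m
          M⊔N≤n   = ℕ.m⊔n≤o⇒m≤o (M ⊔ N) (M′ ⊔ N′) ≤n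
          M′⊔N′≤m = ℕ.m⊔n≤o⇒n≤o (M ⊔ N) (M′ ⊔ N′) ≤m
          M′⊔N′≤n = ℕ.m⊔n≤o⇒n≤o (M ⊔ N) (M′ ⊔ N′) ≤n
      in ℚ.≤-<-trans (product-diff (seq x m) (seq y m) (seq x n) (seq y n))
           (subst (_ ℚ.<_) (trans (cong₂ ℚ._+_ Kδ≡ Lη≡) (ε/2+ε/2≡ε ε))
             (ℚ.+-mono-<
               (bounded-* (x-bound m (ℕ.m⊔n≤o⇒m≤o M N M⊔N≤m))
                 (y-close m n (ℕ.m⊔n≤o⇒m≤o M′ N′ M′⊔N′≤m) (ℕ.m⊔n≤o⇒m≤o M′ N′ M′⊔N′≤n)))
               (bounded-* (y-bound n (ℕ.m⊔n≤o⇒n≤o M N M⊔N≤n))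
                 (x-close m n (ℕ.m⊔n≤o⇒n≤o M′ N′ M′⊔N′≤m) (ℕ.m⊔n≤o⇒n≤o M′ N′ M′⊔N′≤n)))))

ℝ²-setoid : Setoid 0ℓ 0ℓ
ℝ²-setoid = ×-setoid ℝ-setoid ℝ-setoid

open Setoid ℝ²-setoid public
  using () renaming (Carrier to ℝ²; _≈_ to _≈²_; _≉_ to _≉²_)

record PointSet : Set (suc 0ℓ) where
  field
    mem      : Pred ℝ² 0ℓ
    respects : mem Respects _≈²_

open PointSet public

-- Points are compared by _≈²_ only, so that sizes do not count
-- different representations or membership proofs.
elements : PointSet → Setoid 0ℓ 0ℓ
elements S = On.setoid {B = Σ ℝ² (mem S)} ℝ²-setoid proj₁

Infinite : PointSet → Set
Infinite S = Injection (setoid ℕ) (elements S)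

HasSize : PointSet → ℕ → Set
HasSize S n = Inverse (setoid (Fin n)) (elements S)

record IsPartition (S : PointSet) {m : ℕ} (B : Fin m → PointSet) : Set where
  field
    union    : mem S ≐ ⋃ (Fin m) (λ i → mem (B i))
    disjoint : ∀ {i j} → i ≢ j → mem (B i) ⊥ mem (B j)

0² : ℝ²
0² = 0ℝ , 0ℝ

-- The line through b with direction v (a line only when v ≉² 0²).
Line : ℝ² → ℝ² → Pred ℝ² 0ℓ
Line (b₁ , b₂) (v₁ , v₂) p = ∃[ t ] p ≈² (b₁ + t * v₁ , b₂ + t * v₂)

Collinear : ℝ² → ℝ² → ℝ² → Set
Collinear p q r = ∃[ b ] ∃[ v ]
  (v ≉² 0² × Line b v p × Line b v q × Line b v r)

NoThreeCollinear : PointSet → Set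
NoThreeCollinear S = ∀ {p q r} → mem S p → mem S q → mem S r →
  p ≉² q → p ≉² r → q ≉² r → ¬ Collinear p q r

{-# OPTIONS --safe #-}

-- Attach to each edge i < j of the complete graph on ℕ, with nodes sᵢ, the
-- point (sᵢ + sⱼ , sᵢ² + sᵢ sⱼ + sⱼ²).  The edges of a triangle give collinear
-- points, and when the nodes grow fast enough there are no other collinear
-- triples.  Every finite graph has a bipartite, hence triangle-free, subgraph
-- with at least half of its edges, whereas by Ramsey's theorem every finite
-- colouring of the edges has a monochromatic triangle.
module Submission where

open import Defs renaming (_+_ to _+ᴿ_; _*_ to _*ᴿ_)
open import Algebra.Bundles using (CommutativeRing)
import Algebra.Properties.Group
import Algebra.Properties.Semiring.Mult
open import Data.Bool.Base using (Bool; true; false; if_then_else_; T; _xor_)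
open import Data.Bool.Properties using (T?)
open import Data.Empty using (⊥)
open import Data.Fin.Base using (Fin; zero; suc; punchIn; punchOut)
import Data.Fin.Properties as Fin
open import Data.List.Base using (List; []; _∷_; length; map; filter; lookup; tabulate)
open import Data.List.Membership.Propositional using (_∈_)
open import Data.List.Membership.Propositional.Properties using (∈-lookup; ∈-filter⁻; ∈-tabulate⁻)
open import Data.List.Properties using (length-tabulate; length-upTo)
open import Data.List.Relation.Binary.Sublist.Propositional
  using ([]; _∷_; _∷ʳ_) renaming (_⊆_ to _⊑_; ⊆-trans to ⊑-trans)
open import Data.List.Relation.Binary.Sublist.Propositional.Properties using (All-resp-⊆)
open import Data.List.Relation.Unary.All as All using (All; []; _∷_)
open import Data.List.Relation.Unary.AllPairs using (AllPairs; []; _∷_)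
import Data.List.Relation.Unary.AllPairs.Properties as AllPairs
open import Data.List.Relation.Unary.Unique.Propositional using (Unique)
import Data.List.Relation.Unary.Unique.Propositional.Properties as Unique
open import Data.Nat.Base as ℕ using (ℕ; zero; suc; _+_; _*_; _⊔_; _≤_; _<_; s≤s; z<s)
open import Data.Nat.ListAction using (sum)
import Data.Nat.Properties as ℕ
open import Data.Nat.Tactic.RingSolver using (solve-∀)
open import Data.Product.Base using (Σ; ∃-syntax; _×_; _,_; proj₁; proj₂)
open import Data.Rational.Base as ℚ using (ℚ; 0ℚ; 1ℚ; ½; ∣_∣)
import Data.Rational.Properties as ℚ
open import Data.Rational.Solver using (module +-*-Solver)
open import Data.Sum.Base using (_⊎_; inj₁; inj₂)
open import Function.Base using (_∘_)
open import Function.Bundles using (Inverse)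
open import Level using (0ℓ)
open import Relation.Binary.Bundles using (Setoid)
open import Relation.Binary.Core using (Rel)
open import Relation.Binary.Definitions using (tri<; tri≈; tri>)
open import Relation.Binary.PropositionalEquality
  using (_≡_; _≢_; refl; sym; trans; cong; cong₂; subst; subst₂; ≢-sym; module ≡-Reasoning)
open import Relation.Nullary.Decidable using (does; yes; no; dec-true; dec-false)
open import Relation.Nullary.Negation using (¬_; contradiction)
open import Relation.Unary using (Pred; _⊆_)

private
  module ℝ² = Setoid ℝ²-setoid
  module ℚ+ = Algebra.Properties.Group ℚ.+-0-group
  module Mult = Algebra.Properties.Semiring.Mult (CommutativeRing.semiring ℚ.+-*-commutativeRing)

-- Bipartite subgraphs with half of the edges

record Edge : Set where
  constructor edge
  field
    bot top : ℕ
    bot<top : bot < top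

open Edge

Colouring : Set
Colouring = ℕ → Bool

cut : Colouring → Edge → Bool
cut χ e = χ (bot e) xor χ (top e)

_[_]≔_ : Colouring → ℕ → Bool → Colouring
(χ [ v ]≔ b) u = if does (u ℕ.≟ v) then b else χ u

updated : ∀ χ v b → (χ [ v ]≔ b) v ≡ b
updated χ v b rewrite dec-true (v ℕ.≟ v) refl = refl

not-updated : ∀ χ {u v} b → u ≢ v → (χ [ v ]≔ b) u ≡ χ u
not-updated χ {u} {v} b u≢v rewrite dec-false (u ℕ.≟ v) u≢v = refl

cutWeight : Colouring → Edge → ℕ
cutWeight χ e = if cut χ e then 2 else 0

-- Twice the conditional probability that e is cut when the vertices below v
-- keep their colours and all others are recoloured by fair coin flips.
weight : ℕ → Colouring → Edge → ℕ
weight v χ e = if does (top e ℕ.<? v) then cutWeight χ e else 1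

xor-weights : ∀ c →
  (if c xor true then 2 else 0) + (if c xor false then 2 else 0) ≡ 2
xor-weights true  = refl
xor-weights false = refl

-- If `top e` is below `v`, neither recolouring touches `e`. If it is `v`, the bottom already has
-- its colour and exactly one of the two choices cuts `e`, giving weights 2 and 0. If it is above
-- `v`, both weights are still 1.
weight-step : ∀ v χ e →
  weight (suc v) (χ [ v ]≔ true) e + weight (suc v) (χ [ v ]≔ false) e
    ≡ 2 * weight v χ e
weight-step v χ e@(edge i j i<j) with ℕ.<-cmp j v
... | tri< j<v j≢v _
  rewrite dec-true (j ℕ.<? suc v) (ℕ.m<n⇒m<1+n j<v) | dec-true (j ℕ.<? v) j<v
        | not-updated χ true j≢v | not-updated χ false j≢v
        | not-updated χ true (ℕ.<⇒≢ (ℕ.<-trans i<j j<v))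
        | not-updated χ false (ℕ.<⇒≢ (ℕ.<-trans i<j j<v))
  = cong (cutWeight χ e +_) (sym (ℕ.+-identityʳ _))
... | tri≈ _ refl _
  rewrite dec-true (j ℕ.<? suc j) (ℕ.n<1+n j) | dec-false (j ℕ.<? j) (ℕ.n≮n j)
        | updated χ j true | updated χ j false
        | not-updated χ true (ℕ.<⇒≢ i<j) | not-updated χ false (ℕ.<⇒≢ i<j)
  = xor-weights (χ i)
... | tri> j≮v _ v<j
  rewrite dec-false (j ℕ.<? suc v) (ℕ.≤⇒≯ v<j) | dec-false (j ℕ.<? v) j≮v = refl

sum-weight-step : ∀ v χ es →
  sum (map (weight (suc v) (χ [ v ]≔ true)) es)
    + sum (map (weight (suc v) (χ [ v ]≔ false)) es)
    ≡ 2 * sum (map (weight v χ) es)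
sum-weight-step v χ []       = refl
sum-weight-step v χ (e ∷ es) = begin
  (w₁ + s₁) + (w₂ + s₂)  ≡⟨ +-interchange w₁ s₁ w₂ s₂ ⟩
  (w₁ + w₂) + (s₁ + s₂)  ≡⟨ cong₂ _+_ (weight-step v χ e) (sum-weight-step v χ es) ⟩
  2 * w + 2 * s          ≡⟨ ℕ.*-distribˡ-+ 2 w s ⟨
  2 * (w + s)              ∎
  where
  open ≡-Reasoning
  +-interchange : ∀ a b c d → (a + b) + (c + d) ≡ (a + c) + (b + d)
  +-interchange = solve-∀
  w₁ = weight (suc v) (χ [ v ]≔ true) e
  w₂ = weight (suc v) (χ [ v ]≔ false) e
  s₁ = sum (map (weight (suc v) (χ [ v ]≔ true)) es)
  s₂ = sum (map (weight (suc v) (χ [ v ]≔ false)) es)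
  w  = weight v χ e
  s  = sum (map (weight v χ) es)

m+n≡2*o⇒o≤m⊎o≤n : ∀ {m n o} → m + n ≡ 2 * o → o ≤ m ⊎ o ≤ n
m+n≡2*o⇒o≤m⊎o≤n {m} {n} {o} eq with ℕ.≤-<-connex o m
... | inj₁ o≤m = inj₁ o≤m
... | inj₂ m<o with ℕ.≤-<-connex o n
...   | inj₁ o≤n = inj₂ o≤n
...   | inj₂ n<o = contradiction
  (trans eq (cong (o +_) (ℕ.+-identityʳ o))) (ℕ.<⇒≢ (ℕ.+-mono-< m<o n<o))

sum-weight-zero : ∀ χ es → sum (map (weight 0 χ) es) ≡ length es
sum-weight-zero χ []       = refl
sum-weight-zero χ (e ∷ es) = cong suc (sum-weight-zero χ es)

-- Method of conditional expectations: the two colours for the next vertex give totals that average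
-- to the current one, so one of them does not lower it. Before any vertex is fixed the total is one
-- per edge.
heavy-colouring : ∀ v es → ∃[ χ ] length es ≤ sum (map (weight v χ) es)
heavy-colouring zero    es = (λ _ → true) , ℕ.≤-reflexive (sym (sum-weight-zero (λ _ → true) es))
heavy-colouring (suc v) es with heavy-colouring v es
... | χ , es≤ with m+n≡2*o⇒o≤m⊎o≤n (sum-weight-step v χ es)
...   | inj₁ ≤t = χ [ v ]≔ true  , ℕ.≤-trans es≤ ≤t
...   | inj₂ ≤f = χ [ v ]≔ false , ℕ.≤-trans es≤ ≤f

sum-weight-top : ∀ {v} χ {es} → All (λ e → top e < v) es →
  sum (map (weight v χ) es) ≡ sum (map (cutWeight χ) es)
sum-weight-top     χ []                    = refl
sum-weight-top {v} χ {e ∷ _} (e<v ∷ es<v)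
  rewrite dec-true (top e ℕ.<? v) e<v = cong (cutWeight χ e +_) (sum-weight-top χ es<v)

tops-bounded : ∀ es → ∃[ v ] All (λ e → top e < v) es
tops-bounded []       = 0 , []
tops-bounded (e ∷ es) with tops-bounded es
... | v , es<v = suc (top e) ⊔ v
  , ℕ.m≤m⊔n (suc (top e)) v
  ∷ All.map (λ {f} f<v → ℕ.≤-trans f<v (ℕ.m≤n⊔m (suc (top e)) v)) es<v

-- Beyond every top no coin is left to flip, so the expectation is the size of an actual cut. Each
-- cut edge counts 2, which expresses half of the edges without division.
large-cut : ∀ es → ∃[ χ ] length es ≤ sum (map (cutWeight χ) es)
large-cut es =
  let v , es<v = tops-bounded es
      χ , es≤  = heavy-colouring v es
  in χ , subst (length es ≤_) (sum-weight-top χ es<v) es≤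

-- Monochromatic triangles

AllPairs-resp-⊒ : ∀ {V : Set} {R : Rel V 0ℓ} {us vs} → us ⊑ vs → AllPairs R vs → AllPairs R us
AllPairs-resp-⊒ []          []         = []
AllPairs-resp-⊒ (_ ∷ʳ τ)    (_ ∷ ps)   = AllPairs-resp-⊒ τ ps
AllPairs-resp-⊒ (refl ∷ τ)  (p ∷ ps)   = All-resp-⊆ τ p ∷ AllPairs-resp-⊒ τ ps

split : ∀ {V : Set} {m} {Q : Fin (suc m) → Pred V 0ℓ} {vs} →
  All (λ v → ∃[ i ] Q i v) vs →
  ∃[ us ] ∃[ ws ] (us ⊑ vs × ws ⊑ vs × All (Q zero) us
    × All (λ v → ∃[ i ] Q (suc i) v) ws × length vs ≡ length us + length ws)
split [] = [] , [] , [] , [] , [] , [] , refl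
split {vs = v ∷ vs} ((i , q) ∷ qs) with i | q | split qs
... | zero  | q | us , ws , us⊑ , ws⊑ , qus , qws , eq =
  v ∷ us , ws , refl ∷ us⊑ , v ∷ʳ ws⊑ , q ∷ qus , qws , cong suc eq
... | suc i | q | us , ws , us⊑ , ws⊑ , qus , qws , eq =
  us , v ∷ ws , v ∷ʳ us⊑ , refl ∷ ws⊑ , qus , (i , q) ∷ qws
  , trans (cong suc eq) (sym (ℕ.+-suc _ _))

-- Either colour `zero` has more than `n` elements, or dropping them leaves more than `m * n` for
-- the other colours. Classes are sublists so that `AllPairs` passes to them.
pigeonhole : ∀ {V : Set} m n {Q : Fin m → Pred V 0ℓ} {vs} →
  All (λ v → ∃[ i ] Q i v) vs → m * n < length vs →
  ∃[ i ] ∃[ us ] (us ⊑ vs × All (Q i) us × n < length us)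
pigeonhole zero    n (( () , _) ∷ _) _
pigeonhole (suc m) n {vs = vs} qs large with split qs
... | us , ws , us⊑ , ws⊑ , qus , qws , eq with ℕ.≤-<-connex (suc n) (length us)
...   | inj₁ n<us = zero , us , us⊑ , qus , n<us
...   | inj₂ us≤n =
  let i , xs , xs⊑ , qxs , n<xs = pigeonhole m n qws mn<ws
  in suc i , xs , ⊑-trans xs⊑ ws⊑ , qxs , n<xs
  where
  mn<ws : m * n < length ws
  mn<ws = ℕ.+-cancelˡ-< n (m * n) (length ws)
    (ℕ.<-≤-trans large (subst (_≤ n + length ws) (sym eq)
      (ℕ.+-monoˡ-≤ (length ws) (ℕ.s≤s⁻¹ us≤n))))

-- Among more than `suc m * ramsey-bound m` vertices joined to a first one, more than
-- `ramsey-bound m` are joined to it in the same colour; the outer `suc` counts the first vertex.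
-- Without colours, two vertices are already too many.
ramsey-bound : ℕ → ℕ
ramsey-bound zero    = 1
ramsey-bound (suc m) = suc (suc m * ramsey-bound m)

TriangleFree : ∀ {V : Set} → Rel V 0ℓ → Set
TriangleFree R = ∀ {u v w} → R u v → R u w → ¬ R v w

zip-AllPairs : ∀ {V : Set} {P : Pred V 0ℓ} {R S : Rel V 0ℓ} {vs} →
  (∀ {u v} → P u → P v → R u v → S u v) →
  All P vs → AllPairs R vs → AllPairs S vs
zip-AllPairs f []       []       = []
zip-AllPairs f (p ∷ ps) (r ∷ rs) =
  All.zipWith (λ (q , r) → f p q r) (ps , r) ∷ zip-AllPairs f ps rs

-- A colour that joins the first vertex to many others cannot be used among
-- these.
ramsey-triangle : ∀ {V : Set} m (R : Fin m → Rel V 0ℓ) → (∀ i → TriangleFree (R i)) →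
  ∀ {vs} → AllPairs (λ u v → ∃[ i ] R i u v) vs → ¬ (ramsey-bound m < length vs)
ramsey-triangle zero R tf []                    ()
ramsey-triangle zero R tf (_ ∷ [])              (s≤s ())
ramsey-triangle zero R tf (((() , _) ∷ _) ∷ _)  _
ramsey-triangle (suc m) R tf {v ∷ vs} (rs ∷ rss) (s≤s large)
  with pigeonhole (suc m) (ramsey-bound m) rs large
... | i , us , us⊑vs , rus , large′ =
  ramsey-triangle m (λ j → R (punchIn i j)) (λ j → tf (punchIn i j))
    (zip-AllPairs other-colour rus (AllPairs-resp-⊒ us⊑vs rss)) large′
  where
  other-colour : ∀ {u w} → R i v u → R i v w → ∃[ j ] R j u w → ∃[ j ] R (punchIn i j) u w
  other-colour {u} {w} ru rw (j , r) with i Fin.≟ j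
  ... | yes refl = contradiction r (tf i ru rw)
  ... | no  i≢j  = punchOut i≢j , subst (λ k → R k u w) (sym (Fin.punchIn-punchOut i≢j)) r

-- Aligned chords

digit-≮ : ∀ {d r r′ q q′} → r < d → r + q * d ≡ r′ + q′ * d → ¬ q < q′
digit-≮ {d} {r} {r′} {q} {q′} r<d eq q<q′ = ℕ.<⇒≢ (begin-strict
  r + q * d    <⟨ ℕ.+-monoˡ-< (q * d) r<d ⟩
  suc q * d    ≤⟨ ℕ.*-monoˡ-≤ d q<q′ ⟩
  q′ * d       ≤⟨ ℕ.m≤n+m (q′ * d) r′ ⟩
  r′ + q′ * d  ∎) eq
  where open ℕ.≤-Reasoning

-- Used to compare coefficients of polynomials in a large number `d`, stripping one low-order digit
-- at a time.
digit-unique : ∀ {d r r′} q q′ → r < d → r′ < d → r + q * d ≡ r′ + q′ * d → q ≡ q′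
digit-unique q q′ r<d r′<d eq with ℕ.<-cmp q q′
... | tri< q<q′ _ _ = contradiction q<q′ (digit-≮ r<d eq)
... | tri≈ _ q≡q′ _ = q≡q′
... | tri> _ _ q′<q = contradiction q′<q (digit-≮ r′<d (sym eq))

Point : Set
Point = ℕ × ℕ

-- The 3 × 3 determinant with rows (1 , p), (1 , q), (1 , r) vanishes, with its
-- negative terms moved to the right.
Aligned : Point → Point → Point → Set
Aligned (x₁ , y₁) (x₂ , y₂) (x₃ , y₃) =
  x₁ * y₂ + x₂ * y₃ + x₃ * y₁ ≡ x₂ * y₁ + x₃ * y₂ + x₁ * y₃

aligned-rotate : ∀ p q r → Aligned p q r → Aligned q r p
aligned-rotate (x₁ , y₁) (x₂ , y₂) (x₃ , y₃) al =
  trans (rot (x₂ * y₃) (x₃ * y₁) (x₁ * y₂)) (trans al (rot′ (x₂ * y₁) (x₃ * y₂) (x₁ * y₃)))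
  where
  rot : ∀ a b c → a + b + c ≡ c + a + b
  rot = solve-∀
  rot′ : ∀ a b c → a + b + c ≡ b + c + a
  rot′ = solve-∀

aligned-swap : ∀ p q r → Aligned p q r → Aligned q p r
aligned-swap (x₁ , y₁) (x₂ , y₂) (x₃ , y₃) al =
  trans (rev (x₂ * y₁) (x₁ * y₃) (x₃ * y₂)) (trans (sym al) (rev (x₁ * y₂) (x₂ * y₃) (x₃ * y₁)))
  where
  rev : ∀ a b c → a + b + c ≡ a + c + b
  rev = solve-∀

-- The slope of the line through chord s u and chord t u is s + t + u,
-- symmetric in the three, so the three chords of a triple are aligned.
chord : ℕ → ℕ → Point
chord s t = s + t , s * s + s * t + t * t

-- An upper bound for the digits compared below when the alignment of chords
-- ending in M is read as an equation between numbers in base M.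
room : ℕ → ℕ
room z = z * z + z * z + z * z + z

square-bound : ∀ {a b c z} → a ≤ z → b ≤ z → c ≤ z → a * b + c ≤ room z
square-bound {z = z} a≤z b≤z c≤z = ℕ.+-mono-≤
  (ℕ.≤-trans (ℕ.*-mono-≤ a≤z b≤z) (ℕ.m≤n+m (z * z) (z * z + z * z))) c≤z

cube-bound : ∀ {a b c d e f z} → a ≤ z → b ≤ z → c ≤ z → d ≤ z → e ≤ z → f ≤ z →
  a * b + c * d + e * f ≤ room z
cube-bound {z = z} a≤z b≤z c≤z d≤z e≤z f≤z = ℕ.≤-trans
  (ℕ.+-mono-≤ (ℕ.+-mono-≤ (ℕ.*-mono-≤ a≤z b≤z) (ℕ.*-mono-≤ c≤z d≤z)) (ℕ.*-mono-≤ e≤z f≤z))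
  (ℕ.m≤m+n _ z)

module _ {z M : ℕ} (gap : room z < M) where

  -- In powers of `M`, the two sides have leading coefficients `x₂` and `x₁` at `M * M`. Two digit
  -- comparisons strip the lower coefficients.
  aligned-one-chord : ∀ {x₁ y₁ x₂ y₂ m} → x₁ ≤ z → y₁ ≤ z → x₂ ≤ z → y₂ ≤ z →
    m ≤ z → m * m ≤ z → Aligned (x₁ , y₁) (x₂ , y₂) (chord m M) → x₁ ≡ x₂
  aligned-one-chord {x₁} {y₁} {x₂} {y₂} {m} x₁≤ y₁≤ x₂≤ y₂≤ m≤ m²≤ al =
    sym (digit-unique x₂ x₁
      (ℕ.≤-<-trans (square-bound x₂≤ m≤ y₁≤) gap)
      (ℕ.≤-<-trans (square-bound x₁≤ m≤ y₂≤) gap)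
      (digit-unique _ _
        (ℕ.≤-<-trans (cube-bound x₁≤ y₂≤ x₂≤ m²≤ m≤ y₁≤) gap)
        (ℕ.≤-<-trans (cube-bound x₂≤ y₁≤ m≤ y₂≤ x₁≤ m²≤) gap)
        (trans (sym (left x₁ y₁ x₂ y₂ m M)) (trans al (right x₁ y₁ x₂ y₂ m M)))))
    where
    left : ∀ x₁ y₁ x₂ y₂ m M →
      x₁ * y₂ + x₂ * (m * m + m * M + M * M) + (m + M) * y₁ ≡
      x₁ * y₂ + x₂ * (m * m) + m * y₁ + (x₂ * m + y₁ + x₂ * M) * M
    left = solve-∀
    right : ∀ x₁ y₁ x₂ y₂ m M →
      x₂ * y₁ + (m + M) * y₂ + x₁ * (m * m + m * M + M * M) ≡
      x₂ * y₁ + m * y₂ + x₁ * (m * m) + (x₁ * m + y₂ + x₁ * M) * M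
    right = solve-∀

  -- The terms in `M * M` and `M * M * M` agree on both sides, as does a part of the linear term;
  -- `rest` collects them. One digit comparison isolates what remains of the coefficient of `M`.
  aligned-two-chords : ∀ {x y m k} → x ≤ z → y ≤ z → m ≤ z → k ≤ z → m * m ≤ z → k * k ≤ z →
    Aligned (x , y) (chord m M) (chord k M) → x * m + k * k ≡ x * k + m * m
  aligned-two-chords {x} {y} {m} {k} x≤ y≤ m≤ k≤ m²≤ k²≤ al =
    digit-unique _ _
      (ℕ.≤-<-trans (cube-bound x≤ m²≤ m≤ k²≤ k≤ y≤) gap)
      (ℕ.≤-<-trans (cube-bound m≤ y≤ k≤ m²≤ x≤ k²≤) gap)
      (ℕ.+-cancelˡ-≡ (rest x y m k M) _ _
        (trans (sym (left x y m k M)) (trans al (right x y m k M))))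
    where
    rest : ℕ → ℕ → ℕ → ℕ → ℕ → ℕ
    rest x y m k M = (m * k + y) * M + (x + m + k) * (M * M) + M * M * M
    left : ∀ x y m k M →
      x * (m * m + m * M + M * M) + (m + M) * (k * k + k * M + M * M) + (k + M) * y ≡
      ((m * k + y) * M + (x + m + k) * (M * M) + M * M * M)
        + (x * (m * m) + m * (k * k) + k * y + (x * m + k * k) * M)
    left = solve-∀
    right : ∀ x y m k M →
      (m + M) * y + (k + M) * (m * m + m * M + M * M) + x * (k * k + k * M + M * M) ≡
      ((m * k + y) * M + (x + m + k) * (M * M) + M * M * M)
        + (m * y + k * (m * m) + x * (k * k) + (x * k + m * m) * M)
    right = solve-∀

-- The hypothesis says (k - m) (x - (m + k)) = 0.
vieta-< : ∀ {x m k} → m < k → x * m + k * k ≡ x * k + m * m → x ≡ m + k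
vieta-< {x} {m} {k} m<k eq with ℕ.m≤n⇒∃[o]m+o≡n m<k
... | d , refl = sym (ℕ.*-cancelʳ-≡ (m + k) x (suc d)
      (ℕ.+-cancelˡ-≡ (x * m + m * m) _ _
        (trans (sym (left x m d)) (trans eq (right x m d)))))
  where
  left : ∀ x m d → x * m + (suc m + d) * (suc m + d) ≡
                   (x * m + m * m) + (m + (suc m + d)) * suc d
  left = solve-∀
  right : ∀ x m d → x * (suc m + d) + m * m ≡ (x * m + m * m) + x * suc d
  right = solve-∀

vieta : ∀ {x m k} → m ≢ k → x * m + k * k ≡ x * k + m * m → x ≡ m + k
vieta {x} {m} {k} m≢k eq with ℕ.<-cmp m k
... | tri< m<k _ _ = vieta-< m<k eq
... | tri≈ _ m≡k _ = contradiction m≡k m≢k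
... | tri> _ _ k<m = trans (vieta-< k<m (sym eq)) (ℕ.+-comm k m)

-- The determinant is the Vandermonde product (k - m) (l - k) (l - m).
aligned-three-chords-< : ∀ {m k l} M → m < k → m ≢ l → k ≢ l →
  ¬ Aligned (chord m M) (chord k M) (chord l M)
aligned-three-chords-< {m} {k} {l} M m<k m≢l k≢l al with ℕ.m≤n⇒∃[o]m+o≡n m<k
-- Cancelling the factor `k - m = suc d` leaves `l * l + k * m ≡ l * (k + m)`. Adding `m * m` gives
-- the equation of `vieta` for `m`, `l` and `x = k + m`, whence `k + m ≡ m + l`.
... | d , refl = k≢l (ℕ.+-cancelˡ-≡ m k l (trans (ℕ.+-comm m k) (vieta m≢l quadratic)))
  where
  rest : ℕ
  rest = m * (l * l) + m * m * k + l * (m * m)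
      + (m * k + k * k + k * l + l * l + l * m + m * m) * M
      + (m + k + l) * 2 * (M * M) + 3 * (M * M * M)
  left : ∀ m d l M →
    (m + M) * ((suc m + d) * (suc m + d) + (suc m + d) * M + M * M)
      + ((suc m + d) + M) * (l * l + l * M + M * M)
      + (l + M) * (m * m + m * M + M * M) ≡
    (m * (l * l) + m * m * (suc m + d) + l * (m * m)
      + (m * (suc m + d) + (suc m + d) * (suc m + d) + (suc m + d) * l + l * l + l * m + m * m) * M
      + (m + (suc m + d) + l) * 2 * (M * M) + 3 * (M * M * M))
      + (l * l + (suc m + d) * m) * suc d
  left = solve-∀
  right : ∀ m d l M →
    ((suc m + d) + M) * (m * m + m * M + M * M)
      + (l + M) * ((suc m + d) * (suc m + d) + (suc m + d) * M + M * M)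
      + (m + M) * (l * l + l * M + M * M) ≡
    (m * (l * l) + m * m * (suc m + d) + l * (m * m)
      + (m * (suc m + d) + (suc m + d) * (suc m + d) + (suc m + d) * l + l * l + l * m + m * m) * M
      + (m + (suc m + d) + l) * 2 * (M * M) + 3 * (M * M * M))
      + l * ((suc m + d) + m) * suc d
  right = solve-∀
  complete-left : ∀ m k l → (k + m) * m + l * l ≡ (l * l + k * m) + m * m
  complete-left = solve-∀
  quadratic : (k + m) * m + l * l ≡ (k + m) * l + m * m
  quadratic = trans (complete-left m k l) (cong (_+ m * m)
    (trans (ℕ.*-cancelʳ-≡ (l * l + k * m) (l * (k + m)) (suc d)
              (ℕ.+-cancelˡ-≡ rest _ _
                (trans (sym (left m d l M)) (trans al (right m d l M)))))
           (ℕ.*-comm l (k + m))))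

aligned-three-chords : ∀ {m k l} M → m ≢ k → m ≢ l → k ≢ l →
  ¬ Aligned (chord m M) (chord k M) (chord l M)
aligned-three-chords {m} {k} {l} M m≢k m≢l k≢l al with ℕ.<-cmp m k
... | tri< m<k _ _ = aligned-three-chords-< M m<k m≢l k≢l al
... | tri≈ _ m≡k _ = m≢k m≡k
... | tri> _ _ k<m = aligned-three-chords-< M k<m k≢l m≢l
        (aligned-swap (chord m M) (chord k M) (chord l M) al)

-- A fast-growing sequence of nodes

-- For `s` and `t` at most `b`, the first bracket bounds the first coordinate of `chord s t` and the
-- second bracket the second coordinate.
scale-of : ℕ → ℕ
scale-of b = (b + b) + (b * b + b * b + b * b)

-- Each node exceeds `room` of a bound for all chords between earlier nodes, so it can serve as the
-- base `M` in the digit comparisons.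
node : ℕ → ℕ
node zero    = 0
node (suc n) = suc (room (scale-of (node n)))

m≤scale : ∀ b → b ≤ scale-of b
m≤scale b = ℕ.≤-trans (ℕ.m≤m+n b b) (ℕ.m≤m+n (b + b) _)

m*m≤scale : ∀ b → b * b ≤ scale-of b
m*m≤scale b = ℕ.≤-trans (ℕ.m≤n+m (b * b) (b * b + b * b)) (ℕ.m≤n+m _ (b + b))

m≤room : ∀ z → z ≤ room z
m≤room z = ℕ.m≤n+m z _

node-step : ∀ n → node n < node (suc n)
node-step n = s≤s (ℕ.≤-trans (m≤scale (node n)) (m≤room (scale-of (node n))))

node-mono-≤ : ∀ {i j} → i ≤ j → node i ≤ node j
node-mono-≤ i≤j with ℕ.m≤n⇒m<n∨m≡n i≤j
... | inj₂ refl              = ℕ.≤-refl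
... | inj₁ (s≤s {n = n} i≤n) = ℕ.≤-trans (node-mono-≤ i≤n) (ℕ.<⇒≤ (node-step n))

node-mono-< : ∀ {i j} → i < j → node i < node j
node-mono-< {i} i<j = ℕ.<-≤-trans (node-step i) (node-mono-≤ i<j)

node-injective : ∀ {i j} → node i ≡ node j → i ≡ j
node-injective {i} {j} eq with ℕ.<-cmp i j
... | tri< i<j _ _ = contradiction eq (ℕ.<⇒≢ (node-mono-< i<j))
... | tri≈ _ i≡j _ = i≡j
... | tri> _ _ j<i = contradiction (sym eq) (ℕ.<⇒≢ (node-mono-< j<i))

point : Edge → Point
point e = chord (node (bot e)) (node (top e))

xcoord ycoord : Edge → ℕ
xcoord e = proj₁ (point e)
ycoord e = proj₂ (point e)

-- Collects what the lemmas on chords ending in `M = node j` ask for: `z` bounds all data built from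
-- the nodes before `j`.
record Separates (z j : ℕ) : Set where
  field
    gap     : room z < node j
    node≤   : ∀ {i} → i < j → node i ≤ z
    node²≤  : ∀ {i} → i < j → node i * node i ≤ z
    xcoord≤ : ∀ e → top e < j → xcoord e ≤ z
    ycoord≤ : ∀ e → top e < j → ycoord e ≤ z

  xcoord< : ∀ e → top e < j → xcoord e < node j
  xcoord< e e<j = ℕ.≤-<-trans (ℕ.≤-trans (xcoord≤ e e<j) (m≤room z)) gap

-- The hypothesis excludes `j = 0`, where `gap` fails because `node 0` is 0.
separates : ∀ {i j} → i < j → ∃[ z ] Separates z j
separates {j = suc n} _ = scale-of b , record
  { gap     = ℕ.≤-refl
  ; node≤   = λ i<j → ℕ.≤-trans (low i<j) (m≤scale b)
  ; node²≤  = λ i<j → ℕ.≤-trans (ℕ.*-mono-≤ (low i<j) (low i<j)) (m*m≤scale b)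
  ; xcoord≤ = λ e e<j → ℕ.≤-trans
      (ℕ.+-mono-≤ (low (ℕ.<-trans (bot<top e) e<j)) (low e<j)) (ℕ.m≤m+n (b + b) _)
  ; ycoord≤ = λ e e<j →
      let s≤ = low (ℕ.<-trans (bot<top e) e<j)
          t≤ = low e<j
      in ℕ.≤-trans
        (ℕ.+-mono-≤ (ℕ.+-mono-≤ (ℕ.*-mono-≤ s≤ s≤) (ℕ.*-mono-≤ s≤ t≤)) (ℕ.*-mono-≤ t≤ t≤))
        (ℕ.m≤n+m _ (b + b))
  }
  where
  b = node n
  low : ∀ {i} → i < suc n → node i ≤ b
  low (s≤s i≤n) = node-mono-≤ i≤n

-- `node (top f)` is a summand of `xcoord f` and by itself exceeds every first coordinate made from
-- earlier nodes.
xcoord-mono : ∀ e f → top e < top f → xcoord e < xcoord f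
xcoord-mono e f e<f = ℕ.<-≤-trans
  (Separates.xcoord< (proj₂ (separates (bot<top f))) e e<f) (ℕ.m≤n+m _ _)

edge-≡ : ∀ {e f} → bot e ≡ bot f → top e ≡ top f → e ≡ f
edge-≡ {edge i j p} {edge _ _ q} refl refl = cong (edge i j) (ℕ.<-irrelevant p q)

-- Growth determines the top and cancellation then the bottom. Thus distinct edges give distinct
-- points, and a first coordinate suffices to recognise an edge.
xcoord-injective : ∀ {e f} → xcoord e ≡ xcoord f → e ≡ f
xcoord-injective {e} {f} eq with ℕ.<-cmp (top e) (top f)
... | tri< e<f _ _ = contradiction eq (ℕ.<⇒≢ (xcoord-mono e f e<f))
... | tri> _ _ f<e = contradiction (sym eq) (ℕ.<⇒≢ (xcoord-mono f e f<e))
... | tri≈ _ te≡tf _ = edge-≡ be≡bf te≡tf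
  where
  be≡bf : bot e ≡ bot f
  be≡bf = node-injective (ℕ.+-cancelʳ-≡ (node (top e)) _ _
    (trans eq (cong (λ t → node (bot f) + node t) (sym te≡tf))))

-- Aligned triples within a cut

-- The three values add up to 0 modulo 2, so they are not all `true`: a cut contains no triangle.
xor-triangle : ∀ a b c → T (a xor c) → T (b xor c) → ¬ T (a xor b)
xor-triangle true  true  _     _ _  ()
xor-triangle false false _     _ _  ()
xor-triangle true  false true  ()
xor-triangle true  false false _ ()
xor-triangle false true  true  _ ()
xor-triangle false true  false ()

bots-differ : ∀ {e f} → top e ≡ top f → e ≢ f → bot e ≢ bot f
bots-differ te≡tf e≢f be≡bf = e≢f (edge-≡ be≡bf te≡tf)

module _ (χ : Colouring) where

  Cut : Edge → Set
  Cut e = T (cut χ e)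

  -- The first coordinate forces `e` to be the edge joining `i` and `k`, which closes a triangle
  -- with the other two. The cases only orient that edge.
  triangle-not-cut : ∀ {e i k j} (i<j : i < j) (k<j : k < j) → i ≢ k →
    xcoord e ≡ node i + node k → Cut (edge i j i<j) → Cut (edge k j k<j) → ¬ Cut e
  triangle-not-cut {e} {i} {k} {j} _ _ i≢k eq ci ck ce with ℕ.<-cmp i k
  ... | tri< i<k _ _ with refl ← xcoord-injective {e} {edge i k i<k} eq =
    xor-triangle (χ i) (χ k) (χ j) ci ck ce
  ... | tri≈ _ i≡k _ = i≢k i≡k
  ... | tri> _ _ k<i
    with refl ← xcoord-injective {e} {edge k i k<i} (trans eq (ℕ.+-comm (node i) (node k))) =
    xor-triangle (χ k) (χ i) (χ j) ck ci ce

  -- With the common top as base, `aligned-two-chords` and `vieta` show that `xcoord e` is the sum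
  -- of the bottom nodes of `f` and `g`: the triangle case.
  two-at-top : ∀ {e f g} → top e < top g → top f ≡ top g → f ≢ g →
    Cut e → Cut f → Cut g → ¬ Aligned (point e) (point f) (point g)
  two-at-top {e} {f@(edge i j i<j)} {g@(edge k _ k<j)} e<j refl f≢g ce cf cg al =
    triangle-not-cut {e} i<j k<j i≢k
      (vieta (λ eq → i≢k (node-injective eq))
        (aligned-two-chords gap (xcoord≤ e e<j) (ycoord≤ e e<j) (node≤ i<j) (node≤ k<j)
          (node²≤ i<j) (node²≤ k<j) al))
      cf cg ce
    where
    open Separates (proj₂ (separates i<j))
    i≢k = bots-differ {f} {g} refl f≢g

  -- The cases are how many of the edges share the top of `g`. If `g` is alone, `e` and `f` would
  -- have equal first coordinates; if one more shares it, the three edges would form a triangle; if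
  -- all do, the Vandermonde determinant is nonzero.
  highest-last : ∀ {e f g} → e ≢ f → e ≢ g → f ≢ g → top e ≤ top g → top f ≤ top g →
    Cut e → Cut f → Cut g → ¬ Aligned (point e) (point f) (point g)
  highest-last {e} {f} {g} e≢f e≢g f≢g e≤g f≤g ce cf cg al
    with ℕ.m≤n⇒m<n∨m≡n e≤g | ℕ.m≤n⇒m<n∨m≡n f≤g
  ... | inj₁ e<g  | inj₁ f<g = e≢f (xcoord-injective {e} {f}
      (aligned-one-chord gap (xcoord≤ e e<g) (ycoord≤ e e<g) (xcoord≤ f f<g)
        (ycoord≤ f f<g) (node≤ (bot<top g)) (node²≤ (bot<top g)) al))
    where open Separates (proj₂ (separates (bot<top g)))
  ... | inj₁ e<g  | inj₂ f≡g = two-at-top {e} {f} {g} e<g f≡g f≢g ce cf cg al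
  ... | inj₂ e≡g  | inj₁ f<g = two-at-top {f} {e} {g} f<g e≡g e≢g cf ce cg
          (aligned-swap (point e) (point f) (point g) al)
  highest-last {e@(edge i j _)} {f@(edge k _ _)} {g@(edge l _ _)} e≢f e≢g f≢g _ _ _ _ _ al
      | inj₂ refl | inj₂ refl = aligned-three-chords (node j)
          (λ eq → bots-differ {e} {f} refl e≢f (node-injective eq))
          (λ eq → bots-differ {e} {g} refl e≢g (node-injective eq))
          (λ eq → bots-differ {f} {g} refl f≢g (node-injective eq)) al

  -- Alignment is invariant under permutations, so an edge with the highest top can be moved to the
  -- last place.
  cut-edges-not-aligned : ∀ {e f g} → e ≢ f → e ≢ g → f ≢ g →
    Cut e → Cut f → Cut g → ¬ Aligned (point e) (point f) (point g)
  cut-edges-not-aligned {e} {f} {g} e≢f e≢g f≢g ce cf cg al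
    with ℕ.≤-total (top e) (top f) | ℕ.≤-total (top f) (top g) | ℕ.≤-total (top e) (top g)
  ... | inj₁ e≤f | inj₁ f≤g | _        =
    highest-last {e} {f} {g} e≢f e≢g f≢g (ℕ.≤-trans e≤f f≤g) f≤g ce cf cg al
  ... | inj₁ e≤f | inj₂ g≤f | _        =
    highest-last {g} {e} {f} (≢-sym e≢g) (≢-sym f≢g) e≢f g≤f e≤f cg ce cf
      (aligned-rotate (point f) (point g) (point e)
        (aligned-rotate (point e) (point f) (point g) al))
  ... | inj₂ f≤e | _        | inj₁ e≤g =
    highest-last {e} {f} {g} e≢f e≢g f≢g e≤g (ℕ.≤-trans f≤e e≤g) ce cf cg al
  ... | inj₂ f≤e | _        | inj₂ g≤e =
    highest-last {f} {g} {e} f≢g (≢-sym e≢f) (≢-sym e≢g) f≤e g≤e cf cg ce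
      (aligned-rotate (point e) (point f) (point g) al)

-- From real to natural coordinates

pointwise⇒≈ : ∀ {x y} → (∀ n → seq x n ≡ seq y n) → x ≈ y
pointwise⇒≈ {x} {y} x≗y = mk≈ λ ε ε>0 → 0 , λ n _ →
  subst (λ d → ∣ d ∣ ℚ.< ε)
    (sym (trans (cong (ℚ._- seq y n) (x≗y n)) (ℚ.+-inverseʳ (seq y n)))) ε>0

+-cong : ∀ {x x′ y y′} → x ≈ x′ → y ≈ y′ → x +ᴿ y ≈ x′ +ᴿ y′
+-cong {x} {x′} {y} {y′} x≈ y≈ = mk≈ λ ε ε>0 →
  let M , close₁ = difference→0 x≈ (½ ℚ.* ε) (ε/2>0 ε>0)
      N , close₂ = difference→0 y≈ (½ ℚ.* ε) (ε/2>0 ε>0)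
  in M ⊔ N , λ n ≤n →
     ℚ.≤-<-trans (sum-diff (seq x n) (seq y n) (seq x′ n) (seq y′ n))
       (subst (_ ℚ.<_) (ε/2+ε/2≡ε ε)
         (ℚ.+-mono-< (close₁ n (ℕ.m⊔n≤o⇒m≤o M N ≤n)) (close₂ n (ℕ.m⊔n≤o⇒n≤o M N ≤n))))

*-cong : ∀ {x x′ y y′} → x ≈ x′ → y ≈ y′ → x *ᴿ y ≈ x′ *ᴿ y′
*-cong {x} {x′} {y} {y′} x≈ y≈ = mk≈ λ ε ε>0 →
  let K , M , K>0 , x-bound  = eventually-bounded x
      L , N , L>0 , y′-bound = eventually-bounded y′
      instance
        K-pos = ℚ.positive K>0
        L-pos = ℚ.positive L>0
      δ , δ>0 , Kδ≡ = scale K (½ ℚ.* ε) (ε/2>0 ε>0)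
      η , η>0 , Lη≡ = scale L (½ ℚ.* ε) (ε/2>0 ε>0)
      M′ , y-close = difference→0 y≈ δ δ>0
      N′ , x-close = difference→0 x≈ η η>0
  in (M ⊔ N) ⊔ (M′ ⊔ N′) , λ n ≤n →
    let M⊔N≤n   = ℕ.m⊔n≤o⇒m≤o (M ⊔ N) (M′ ⊔ N′) ≤n
        M′⊔N′≤n = ℕ.m⊔n≤o⇒n≤o (M ⊔ N) (M′ ⊔ N′) ≤n
    in ℚ.≤-<-trans (product-diff (seq x n) (seq y n) (seq x′ n) (seq y′ n))
         (subst (_ ℚ.<_) (trans (cong₂ ℚ._+_ Kδ≡ Lη≡) (ε/2+ε/2≡ε ε))
           (ℚ.+-mono-<
             (bounded-* (x-bound n (ℕ.m⊔n≤o⇒m≤o M N M⊔N≤n))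
               (y-close n (ℕ.m⊔n≤o⇒m≤o M′ N′ M′⊔N′≤n)))
             (bounded-* (y′-bound n (ℕ.m⊔n≤o⇒n≤o M N M⊔N≤n))
               (x-close n (ℕ.m⊔n≤o⇒n≤o M′ N′ M′⊔N′≤n)))))

fromℚ-injective : ∀ {p q} → fromℚ p ≈ fromℚ q → p ≡ q
fromℚ-injective {p} {q} p≈q with 0ℚ ℚ.<? ∣ p ℚ.- q ∣
-- With `ε` equal to the constant difference, that difference would be smaller than itself.
... | yes d>0 =
  let N , close = difference→0 p≈q ∣ p ℚ.- q ∣ d>0
  in contradiction (close N ℕ.≤-refl) (ℚ.<-irrefl refl)
... | no d≯0 = begin
  p                  ≡⟨ solve 2 (λ p q → p := (p :- q) :+ q) refl p q ⟩
  (p ℚ.- q) ℚ.+ q    ≡⟨ cong (ℚ._+ q) p-q≡0 ⟩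
  0ℚ ℚ.+ q           ≡⟨ ℚ.+-identityˡ q ⟩
  q                  ∎
  where
  open +-*-Solver
  open ≡-Reasoning
  p-q≡0 = ℚ.∣p∣≡0⇒p≡0 (p ℚ.- q) (ℚ.≤-antisym (ℚ.≮⇒≥ d≯0) (ℚ.0≤∣p∣ (p ℚ.- q)))

-- As an iterated sum of `1ℚ`, it inherits compatibility with addition and multiplication from
-- general facts about semirings.
ι : ℕ → ℚ
ι n = n Mult.× 1ℚ

ι-+ : ∀ m n → ι (m + n) ≡ ι m ℚ.+ ι n
ι-+ = Mult.×-homo-+ 1ℚ

ι-* : ∀ m n → ι (m * n) ≡ ι m ℚ.* ι n
ι-* = Mult.×1-homo-*

ι-nonneg : ∀ n → 0ℚ ℚ.≤ ι n
ι-nonneg zero    = ℚ.≤-refl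
ι-nonneg (suc n) = ℚ.+-mono-≤ (ℚ.<⇒≤ (ℚ.positive⁻¹ 1ℚ)) (ι-nonneg n)

ι-suc≢0 : ∀ n → ι (suc n) ≢ 0ℚ
ι-suc≢0 n = ≢-sym (ℚ.<⇒≢ (ℚ.+-mono-<-≤ (ℚ.positive⁻¹ 1ℚ) (ι-nonneg n)))

ι-injective : ∀ {m n} → ι m ≡ ι n → m ≡ n
ι-injective {zero}  {zero}  eq = refl
ι-injective {zero}  {suc n} eq = contradiction (sym eq) (ι-suc≢0 n)
ι-injective {suc m} {zero}  eq = contradiction eq (ι-suc≢0 m)
ι-injective {suc m} {suc n} eq = cong suc (ι-injective (ℚ+.∙-cancelˡ 1ℚ (ι m) (ι n) eq))

embed : Point → ℝ²
embed (x , y) = fromℚ (ι x) , fromℚ (ι y)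

embed-injective : ∀ p q → embed p ≈² embed q → p ≡ q
embed-injective _ _ (x≈ , y≈) =
  cong₂ _,_ (ι-injective (fromℚ-injective x≈)) (ι-injective (fromℚ-injective y≈))

ι-cyclic : ∀ a b c d e f → ι (a * b + c * d + e * f) ≡
  ι a ℚ.* ι b ℚ.+ ι c ℚ.* ι d ℚ.+ ι e ℚ.* ι f
ι-cyclic a b c d e f = trans (ι-+ (a * b + c * d) (e * f))
  (cong₂ ℚ._+_ (trans (ι-+ (a * b) (c * d)) (cong₂ ℚ._+_ (ι-* a b) (ι-* c d))) (ι-* e f))

cyclic-cong : ∀ {a a′ b b′ c c′ d d′ e e′ f f′} →
  a ≈ a′ → b ≈ b′ → c ≈ c′ → d ≈ d′ → e ≈ e′ → f ≈ f′ →
  a *ᴿ b +ᴿ c *ᴿ d +ᴿ e *ᴿ f ≈ a′ *ᴿ b′ +ᴿ c′ *ᴿ d′ +ᴿ e′ *ᴿ f′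
cyclic-cong {a} {a′} {b} {b′} {c} {c′} {d} {d′} {e} {e′} {f} {f′} a≈ b≈ c≈ d≈ e≈ f≈ =
  +-cong {a *ᴿ b +ᴿ c *ᴿ d} {a′ *ᴿ b′ +ᴿ c′ *ᴿ d′} {e *ᴿ f} {e′ *ᴿ f′}
    (+-cong {a *ᴿ b} {a′ *ᴿ b′} {c *ᴿ d} {c′ *ᴿ d′}
      (*-cong {a} {a′} {b} {b′} a≈ b≈) (*-cong {c} {c′} {d} {d′} c≈ d≈))
    (*-cong {e} {e′} {f} {f′} e≈ f≈)

-- Inserting the parametrisations of the three points turns the equation into a polynomial identity
-- in `b`, `v` and the parameters, which holds at every index of the representing sequences.
collinear⇒determinant : ∀ {x₁ y₁ x₂ y₂ x₃ y₃} →
  Collinear (x₁ , y₁) (x₂ , y₂) (x₃ , y₃) →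
  x₁ *ᴿ y₂ +ᴿ x₂ *ᴿ y₃ +ᴿ x₃ *ᴿ y₁ ≈ x₂ *ᴿ y₁ +ᴿ x₃ *ᴿ y₂ +ᴿ x₁ *ᴿ y₃
collinear⇒determinant {x₁} {y₁} {x₂} {y₂} {x₃} {y₃}
  ((b₁ , b₂) , (v₁ , v₂) , _ , (r , x₁≈ , y₁≈) , (s , x₂≈ , y₂≈) , (t , x₃≈ , y₃≈)) =
  ≈-trans {x₁ *ᴿ y₂ +ᴿ x₂ *ᴿ y₃ +ᴿ x₃ *ᴿ y₁} {X r *ᴿ Y s +ᴿ X s *ᴿ Y t +ᴿ X t *ᴿ Y r}
          {x₂ *ᴿ y₁ +ᴿ x₃ *ᴿ y₂ +ᴿ x₁ *ᴿ y₃}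
    (cyclic-cong {x₁} {X r} {y₂} {Y s} {x₂} {X s} {y₃} {Y t} {x₃} {X t} {y₁} {Y r}
      x₁≈ y₂≈ x₂≈ y₃≈ x₃≈ y₁≈)
    (≈-trans {X r *ᴿ Y s +ᴿ X s *ᴿ Y t +ᴿ X t *ᴿ Y r} {X s *ᴿ Y r +ᴿ X t *ᴿ Y s +ᴿ X r *ᴿ Y t}
             {x₂ *ᴿ y₁ +ᴿ x₃ *ᴿ y₂ +ᴿ x₁ *ᴿ y₃}
      (pointwise⇒≈ {X r *ᴿ Y s +ᴿ X s *ᴿ Y t +ᴿ X t *ᴿ Y r} {X s *ᴿ Y r +ᴿ X t *ᴿ Y s +ᴿ X r *ᴿ Y t}
        λ n → identity (seq b₁ n) (seq b₂ n) (seq v₁ n) (seq v₂ n) (seq r n) (seq s n) (seq t n))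
      (≈-sym {x₂ *ᴿ y₁ +ᴿ x₃ *ᴿ y₂ +ᴿ x₁ *ᴿ y₃} {X s *ᴿ Y r +ᴿ X t *ᴿ Y s +ᴿ X r *ᴿ Y t}
        (cyclic-cong {x₂} {X s} {y₁} {Y r} {x₃} {X t} {y₂} {Y s} {x₁} {X r} {y₃} {Y t}
          x₂≈ y₁≈ x₃≈ y₂≈ x₁≈ y₃≈)))
  where
  X Y : ℝ → ℝ
  X t = b₁ +ᴿ t *ᴿ v₁
  Y t = b₂ +ᴿ t *ᴿ v₂
  open +-*-Solver
  identity : ∀ b₁ b₂ v₁ v₂ r s t →
    (b₁ ℚ.+ r ℚ.* v₁) ℚ.* (b₂ ℚ.+ s ℚ.* v₂) ℚ.+ (b₁ ℚ.+ s ℚ.* v₁) ℚ.* (b₂ ℚ.+ t ℚ.* v₂)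
      ℚ.+ (b₁ ℚ.+ t ℚ.* v₁) ℚ.* (b₂ ℚ.+ r ℚ.* v₂) ≡
    (b₁ ℚ.+ s ℚ.* v₁) ℚ.* (b₂ ℚ.+ r ℚ.* v₂) ℚ.+ (b₁ ℚ.+ t ℚ.* v₁) ℚ.* (b₂ ℚ.+ s ℚ.* v₂)
      ℚ.+ (b₁ ℚ.+ r ℚ.* v₁) ℚ.* (b₂ ℚ.+ t ℚ.* v₂)
  identity = solve 7 (λ b₁ b₂ v₁ v₂ r s t →
    (b₁ :+ r :* v₁) :* (b₂ :+ s :* v₂) :+ (b₁ :+ s :* v₁) :* (b₂ :+ t :* v₂)
      :+ (b₁ :+ t :* v₁) :* (b₂ :+ r :* v₂) :=
    (b₁ :+ s :* v₁) :* (b₂ :+ r :* v₂) :+ (b₁ :+ t :* v₁) :* (b₂ :+ s :* v₂)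
      :+ (b₁ :+ r :* v₁) :* (b₂ :+ t :* v₂)) refl

collinear⇒aligned : ∀ p q r → Collinear (embed p) (embed q) (embed r) → Aligned p q r
collinear⇒aligned (x₁ , y₁) (x₂ , y₂) (x₃ , y₃) col = ι-injective (begin
  ι (x₁ * y₂ + x₂ * y₃ + x₃ * y₁)                    ≡⟨ ι-cyclic x₁ y₂ x₂ y₃ x₃ y₁ ⟩
  ι x₁ ℚ.* ι y₂ ℚ.+ ι x₂ ℚ.* ι y₃ ℚ.+ ι x₃ ℚ.* ι y₁  ≡⟨ determinant ⟩
  ι x₂ ℚ.* ι y₁ ℚ.+ ι x₃ ℚ.* ι y₂ ℚ.+ ι x₁ ℚ.* ι y₃  ≡⟨ ι-cyclic x₂ y₁ x₃ y₂ x₁ y₃ ⟨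
  ι (x₂ * y₁ + x₃ * y₂ + x₁ * y₃)                    ∎)
  where
  open ≡-Reasoning
  -- Both sides have constant sequences but Cauchy proofs other than those of `fromℚ`. Since
  -- `difference→0` mentions the sequences only, rewrapping it changes the reals compared.
  determinant = fromℚ-injective (mk≈ (difference→0 (collinear⇒determinant col)))

Collinear-resp-≈² : ∀ {p p′ q q′ r r′} → p ≈² p′ → q ≈² q′ → r ≈² r′ →
  Collinear p q r → Collinear p′ q′ r′
Collinear-resp-≈² p≈ q≈ r≈ (b , v , v≉0 , (s , p∈) , (t , q∈) , (u , r∈)) =
  b , v , v≉0 , (s , move p≈ p∈) , (t , move q≈ q∈) , (u , move r≈ r∈)
  where
  move : ∀ {p p′ q} → p ≈² p′ → p ≈² q → p′ ≈² q
  move (x≈ , y≈) (x≈′ , y≈′) = ≈-trans (≈-sym x≈) x≈′ , ≈-trans (≈-sym y≈) y≈′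

-- All three chords lie on y = (s + t + u) x - (s t + s u + t u), where they
-- are parametrised by x.
chords-collinear : ∀ s t u →
  Collinear (embed (chord s t)) (embed (chord s u)) (embed (chord t u))
chords-collinear s t u =
  (0ℝ , fromℚ b) , (fromℚ 1ℚ , fromℚ v)
  , (λ v≈0 → contradiction (fromℚ-injective (proj₁ v≈0)) λ ())
  , on-line {b} {v} s t (identity₁ σ τ υ)
  , on-line {b} {v} s u (identity₂ σ τ υ)
  , on-line {b} {v} t u (identity₃ σ τ υ)
  where
  open +-*-Solver
  σ = ι s
  τ = ι t
  υ = ι u
  b = ℚ.- (σ ℚ.* τ ℚ.+ σ ℚ.* υ ℚ.+ τ ℚ.* υ)
  v = σ ℚ.+ τ ℚ.+ υ
  on-line : ∀ {b v} m k →
    ι m ℚ.* ι m ℚ.+ ι m ℚ.* ι k ℚ.+ ι k ℚ.* ι k ≡ b ℚ.+ (ι m ℚ.+ ι k) ℚ.* v →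
    Line (0ℝ , fromℚ b) (fromℚ 1ℚ , fromℚ v) (embed (chord m k))
  on-line m k eq = fromℚ (ι m ℚ.+ ι k)
    , pointwise⇒≈ (λ _ → trans (ι-+ m k) (sym (trans (ℚ.+-identityˡ _) (ℚ.*-identityʳ _))))
    , pointwise⇒≈ (λ _ → trans (ι-cyclic m m m k k k) eq)
  identity₁ : ∀ σ τ υ → σ ℚ.* σ ℚ.+ σ ℚ.* τ ℚ.+ τ ℚ.* τ ≡
    ℚ.- (σ ℚ.* τ ℚ.+ σ ℚ.* υ ℚ.+ τ ℚ.* υ) ℚ.+ (σ ℚ.+ τ) ℚ.* (σ ℚ.+ τ ℚ.+ υ)
  identity₁ = solve 3 (λ σ τ υ → σ :* σ :+ σ :* τ :+ τ :* τ :=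
    :- (σ :* τ :+ σ :* υ :+ τ :* υ) :+ (σ :+ τ) :* (σ :+ τ :+ υ)) refl
  identity₂ : ∀ σ τ υ → σ ℚ.* σ ℚ.+ σ ℚ.* υ ℚ.+ υ ℚ.* υ ≡
    ℚ.- (σ ℚ.* τ ℚ.+ σ ℚ.* υ ℚ.+ τ ℚ.* υ) ℚ.+ (σ ℚ.+ υ) ℚ.* (σ ℚ.+ τ ℚ.+ υ)
  identity₂ = solve 3 (λ σ τ υ → σ :* σ :+ σ :* υ :+ υ :* υ :=
    :- (σ :* τ :+ σ :* υ :+ τ :* υ) :+ (σ :+ υ) :* (σ :+ τ :+ υ)) refl
  identity₃ : ∀ σ τ υ → τ ℚ.* τ ℚ.+ τ ℚ.* υ ℚ.+ υ ℚ.* υ ≡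
    ℚ.- (σ ℚ.* τ ℚ.+ σ ℚ.* υ ℚ.+ τ ℚ.* υ) ℚ.+ (τ ℚ.+ υ) ℚ.* (σ ℚ.+ τ ℚ.+ υ)
  identity₃ = solve 3 (λ σ τ υ → τ :* τ :+ τ :* υ :+ υ :* υ :=
    :- (σ :* τ :+ σ :* υ :+ τ :* υ) :+ (τ :+ υ) :* (σ :+ τ :+ υ)) refl

-- The point set

image : ∀ {I : Set} → (I → ℝ²) → PointSet
image f = record
  { mem      = λ q → ∃[ i ] q ≈² f i
  ; respects = λ q≈r (i , q≈) → i , ℝ².trans (ℝ².sym q≈r) q≈
  }

image-size : ∀ {k} (f : Fin k → ℝ²) → (∀ {s t} → f s ≈² f t → s ≡ t) → HasSize (image f) k
image-size f f-injective = record
  { to        = λ t → f t , t , ℝ².refl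
  ; from      = λ (_ , t , _) → t
  ; to-cong   = λ { refl → ℝ².refl }
  ; from-cong = λ { {_ , _ , q≈} {_ , _ , r≈} q≈r →
                  f-injective (ℝ².trans (ℝ².sym q≈) (ℝ².trans q≈r r≈)) }
  ; inverse   = (λ { {_ , _ , q≈} refl → ℝ².sym q≈ })
              , (λ { {_} {_ , _ , q≈} q≈ft → f-injective (ℝ².trans (ℝ².sym q≈) q≈ft) })
  }

lookup-injective : ∀ {X : Set} {xs : List X} → Unique xs →
  ∀ {i j} → lookup xs i ≡ lookup xs j → i ≡ j
lookup-injective (x∉ ∷ _)  {zero}  {zero}  eq = refl
lookup-injective (x∉ ∷ _)  {zero}  {suc j} eq = contradiction eq (All.lookup x∉ (∈-lookup j))
lookup-injective (x∉ ∷ _)  {suc i} {zero}  eq = contradiction (sym eq) (All.lookup x∉ (∈-lookup i))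
lookup-injective (_  ∷ uq) {suc i} {suc j} eq = cong suc (lookup-injective uq eq)

sum-cutWeight : ∀ χ es → sum (map (cutWeight χ) es) ≡ 2 * length (filter (T? ∘ cut χ) es)
sum-cutWeight χ []       = refl
sum-cutWeight χ (e ∷ es) with cut χ e
... | false = sum-cutWeight χ es
... | true  = trans (cong (2 +_) (sum-cutWeight χ es)) (sym (ℕ.*-suc 2 _))

place : Edge → ℝ²
place e = embed (point e)

place-injective : ∀ e f → place e ≈² place f → e ≡ f
place-injective e f pe≈pf =
  xcoord-injective (cong proj₁ (embed-injective (point e) (point f) pe≈pf))

A₀ : PointSet
A₀ = image place

A₀-infinite : Infinite A₀
A₀-infinite = record
  { to        = λ n → place (star n) , star n , ℝ².refl
  ; cong      = λ { refl → ℝ².refl }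
  ; injective = λ {m} {n} eq → ℕ.suc-injective (cong top (place-injective (star m) (star n) eq))
  }
  where
  star : ℕ → Edge
  star n = edge 0 (suc n) z<s

-- Half of a finite subset in general position

module _ {n} {P : PointSet} (P⊆A : mem P ⊆ mem A₀) (P-size : HasSize P n) where
  open Inverse P-size

  edge-at : Fin n → Edge
  edge-at i = proj₁ (P⊆A (proj₂ (to i)))

  to≈place : ∀ i → proj₁ (to i) ≈² place (edge-at i)
  to≈place i = proj₂ (P⊆A (proj₂ (to i)))

  -- Indices with the same edge name `≈²`-equal points, which the inverse of `to` identifies. Hence
  -- the list of edges of `P` has no repetitions.
  edge-at-injective : ∀ {i j} → edge-at i ≡ edge-at j → i ≡ j
  edge-at-injective {i} {j} eq = trans (sym (inverseʳ {i} {to i} ℝ².refl)) (inverseʳ {j} {to i}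
    (ℝ².trans (to≈place i) (ℝ².trans (ℝ².reflexive (cong place eq)) (ℝ².sym (to≈place j)))))

  -- `P` is read as a finite graph with `n` edges. `P′` consists of the edges in a large cut, where
  -- `cut-edges-not-aligned` applies.
  half-in-general-position :
    ∃[ P′ ] (mem P′ ⊆ mem P × (∃[ k ] (HasSize P′ k × n ≤ 2 * k)) × NoThreeCollinear P′)
  half-in-general-position =
    image vertex , vertex∈P
    , (length cs , image-size vertex vertex-injective , n≤2k)
    , no-three
    where
    es = tabulate edge-at
    χ  = proj₁ (large-cut es)
    cs = filter (T? ∘ cut χ) es

    vertex : Fin (length cs) → ℝ²
    vertex t = place (lookup cs t)

    cs-unique : Unique cs
    cs-unique = Unique.filter⁺ (T? ∘ cut χ) (Unique.tabulate⁺ edge-at-injective)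

    vertex-injective : ∀ {s t} → vertex s ≈² vertex t → s ≡ t
    vertex-injective {s} {t} =
      lookup-injective cs-unique ∘ place-injective (lookup cs s) (lookup cs t)

    n≤2k : n ≤ 2 * length cs
    n≤2k = subst₂ _≤_ (length-tabulate edge-at) (sum-cutWeight χ es) (proj₂ (large-cut es))

    cs⊆es×cut : ∀ t → lookup cs t ∈ es × T (cut χ (lookup cs t))
    cs⊆es×cut t = ∈-filter⁻ (T? ∘ cut χ) {xs = es} (∈-lookup {xs = cs} t)

    vertex∈P : mem (image vertex) ⊆ mem P
    vertex∈P (t , q≈) with i , eq ← ∈-tabulate⁻ (proj₁ (cs⊆es×cut t)) =
      respects P
        (ℝ².trans (to≈place i) (ℝ².trans (ℝ².reflexive (cong place (sym eq))) (ℝ².sym q≈)))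
        (proj₂ (to i))

    distinct : ∀ {p q s t} → p ≈² vertex s → q ≈² vertex t → p ≉² q → lookup cs s ≢ lookup cs t
    distinct p≈ q≈ p≉q eq =
      p≉q (ℝ².trans p≈ (ℝ².trans (ℝ².reflexive (cong place eq)) (ℝ².sym q≈)))

    no-three : NoThreeCollinear (image vertex)
    no-three (s , p≈) (t , q≈) (u , r≈) p≉q p≉r q≉r col =
      cut-edges-not-aligned χ
        (distinct p≈ q≈ p≉q) (distinct p≈ r≈ p≉r) (distinct q≈ r≈ q≉r)
        (proj₂ (cs⊆es×cut s)) (proj₂ (cs⊆es×cut t)) (proj₂ (cs⊆es×cut u))
        (collinear⇒aligned (point (lookup cs s)) (point (lookup cs t)) (point (lookup cs u))
          (Collinear-resp-≈² p≈ q≈ r≈ col))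

-- No finite partition into sets in general position

module _ {m} (B : Fin m → PointSet) (A₀⊆⋃B : ∀ {p} → mem A₀ p → ∃[ i ] mem (B i) p)
         (general : ∀ i → NoThreeCollinear (B i)) where

  -- The colour of a pair is a class containing the point of its edge, kept as a relation in the
  -- form that `ramsey-triangle` takes.
  Joined : Fin m → Rel ℕ 0ℓ
  Joined i u v = Σ (u < v) λ u<v → mem (B i) (place (edge u v u<v))

  -- The edges of a triangle are collinear by `chords-collinear`, and any two of them differ in
  -- their top or bottom, so their points are distinct.
  joined-triangle-free : ∀ i → TriangleFree (Joined i)
  joined-triangle-free i {u} {v} {w} (u<v , uv) (u<w , uw) (v<w , vw) =
    general i uv uw vw
      (λ eq → ℕ.<⇒≢ v<w (cong top (place-injective (edge u v u<v) (edge u w u<w) eq)))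
      (λ eq → ℕ.<⇒≢ u<v (cong bot (place-injective (edge u v u<v) (edge v w v<w) eq)))
      (λ eq → ℕ.<⇒≢ u<v (cong bot (place-injective (edge u w u<w) (edge v w v<w) eq)))
      (chords-collinear (node u) (node v) (node w))

  not-covered : ⊥
  not-covered = ramsey-triangle m Joined joined-triangle-free
    -- The vertices are the numbers from 0 to `ramsey-bound m`, one more than the bound allows.
    (AllPairs.applyUpTo⁺₁ (λ u → u) (suc (ramsey-bound m)) λ {u} {v} u<v _ →
      let i , ∈Bi = A₀⊆⋃B (edge u v u<v , ℝ².refl) in i , u<v , ∈Bi)
    (ℕ.≤-reflexive (sym (length-upTo _)))

theorem1p1 : ∃[ A ]
    ( Infinite A
    × (∀ (n : ℕ) → 0 < n →
    ∀ (P : PointSet) → mem P ⊆ mem A → HasSize P n →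
    ∃[ P′ ] (mem P′ ⊆ mem P
    × (∃[ k ] (HasSize P′ k × n ≤ 2 ℕ.* k))
    × NoThreeCollinear P′))
    × ¬ (∃[ m ] Σ (Fin m → PointSet) λ B →
    IsPartition A B × (∀ i → NoThreeCollinear (B i))) )
theorem1p1 = A₀ , A₀-infinite
  , (λ n _ P P⊆A P-size → half-in-general-position {P = P} P⊆A P-size)
  , λ (m , B , partition , general) →
      not-covered B (proj₁ (IsPartition.union partition)) general
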